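{- Let $\mathcal{P}_4$ be the family of planar graphs having girth at least $4$. The nimber of the game $BS_2(\mathcal{P}_4 : p, q)$ is $0$ for all integers $p, q \geq 3$.
   Context: The girth of a graph is the length of a shortest cycle (infinite if there is no cycle); a pair of parallel edges counts as a cycle of length 2. The game $BS_2(\mathcal{P}_4:p,q)$ ($2$-Brussels sprout for $\mathcal{P}_4$) is the following two-player game, drawn in the plane. Initially there are two spots (vertices), having $p$ and $q$ open tips (short free partial edges) coming out of them, respectively. The players move alternately. A valid move consists of joining two distinct open tips by a curve that crosses neither itself nor any previously drawn curve, and then drawing a crossbar on this curve: the intersection of the crossbar with the curve is a new vertex, which has two new open tips, one on each side of the curve. The two joined tips are no longer open. The associated graph has as vertices the spots and the curve/crossbar intersections, and as edges the curve pieces joining two such vertices (so each move adds one vertex and two edges); it must belong to $\mathcal{P}_4$ at all times. The first player unable to make a valid move loses. The nimber of a finite impartial game is defined recursively: positions with no move have nimber $0$, and every other position has nimber equal to the least non-negative integer that is not the nimber of a position reachable in one move. -}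

module Defs where

open import Data.Fin.Base using (Fin; zero; suc; inject₁; fromℕ)
open import Data.List.Base using (List; []; _∷_; [_]; _++_; length; lookup; replicate)
open import Data.List.Relation.Ternary.Interleaving.Propositional using (Interleaving)
open import Data.Nat.Base using (ℕ; zero; suc; _≤_; _<_; NonZero)
open import Data.Nat.Properties using (<-cmp)
open import Data.Product.Base using (_×_; _,_; ∃-syntax)
open import Data.Sum.Base using (_⊎_)
open import Function.Base using (_∘_)
open import Function.Definitions using (Injective)
open import Relation.Binary.Definitions using (tri<; tri≈; tri>)
open import Relation.Binary.PropositionalEquality.Core using (_≡_; _≢_; refl)
open import Relation.Nullary.Negation.Core using (contradiction)

-- Finite multigraphs.  The vertices are 0, …, order - 1, so that `order` is
-- always a fresh name; an edge is an unordered pair, stored in either order.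

Vertex : Set
Vertex = ℕ

record Graph : Set where
  constructor graph
  field
    order : ℕ
    edges : List (Vertex × Vertex)

open Graph public

Joins : Vertex × Vertex → Vertex → Vertex → Set
Joins e u v = e ≡ (u , v) ⊎ e ≡ (v , u)

-- `vertex` is a closed walk v₀, …, vₖ = v₀ whose i-th step uses the edge
-- `edge i`.  Edges are given by their position in the list, so two parallel
-- edges are distinct and form a cycle of length 2 (and a loop has length 1).

record Cycle (G : Graph) (k : ℕ) : Set where
  field
    {{nonZero}}      : NonZero k
    vertex           : Fin (suc k) → Vertex
    edge             : Fin k → Fin (length (edges G))
    joins            : ∀ i → Joins (lookup (edges G) (edge i))
                                   (vertex (inject₁ i)) (vertex (suc i))
    closed           : vertex (fromℕ k) ≡ vertex zero
    vertex-injective : Injective _≡_ _≡_ (vertex ∘ inject₁)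
    edge-injective   : Injective _≡_ _≡_ edge

-- The shortest cycle, if there is a cycle at all, has length at least g.

GirthAtLeast : ℕ → Graph → Set
GirthAtLeast g G = ∀ {k} → Cycle G k → g ≤ k

-- A plane drawing, up to deformation, is recorded by its regions (the
-- connected components of the complement).  A region is given by its boundary
-- components, and a boundary component by the open tips met when following it
-- with the region on the left.  A tip is represented by the vertex it comes out
-- of.  Boundaries are cyclic words: where the list starts is irrelevant.
-- The unbounded region is not marked, since this does not affect which tips
-- can be joined, now or later.

Boundary : Set
Boundary = List Vertex

Region : Set
Region = List Boundary

record Position : Set where
  constructor position
  field
    drawn   : Graph
    regions : List Region

open Position public

-- `Connect w x y R Rs`: inside the region R, an open tip at x and another one
-- at y are joined by a curve carrying the new vertex w, and Rs are the
-- resulting regions.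
--
-- * If the tips lie on the same boundary component, the curve cuts R in two
--   (Jordan); each half has one of the two tips of w, and every other
--   boundary component of R may be on either side of the curve.
-- * If they lie on different boundary components, these become a single one,
--   which follows both sides of the curve and so meets both tips of w.
--
-- A curve has no direction, so it is enough to consider the tips in the order
-- in which they are listed in R.

data Connect (w x y : Vertex) (R : Region) : List Region → Set where
  same : ∀ Cs₁ A B C Cs₂ {L L′} →
         R ≡ Cs₁ ++ [ A ++ x ∷ B ++ y ∷ C ] ++ Cs₂ →
         Interleaving L L′ (Cs₁ ++ Cs₂) →
         Connect w x y R (((B ++ [ w ]) ∷ L) ∷ ((C ++ A ++ [ w ]) ∷ L′) ∷ [])
  different : ∀ Cs₁ A B Cs₂ C D Cs₃ →
         R ≡ Cs₁ ++ [ A ++ x ∷ B ] ++ Cs₂ ++ [ C ++ y ∷ D ] ++ Cs₃ →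
         Connect w x y R
           [ (B ++ A ++ [ w ] ++ D ++ C ++ [ w ]) ∷ Cs₁ ++ Cs₂ ++ Cs₃ ]

subdividedEdge : Vertex → Vertex → Graph → Graph
subdividedEdge x y G =
  graph (suc (order G)) ((x , order G) ∷ (order G , y) ∷ edges G)

-- The valid moves when the associated graph has to stay in the family F.

data Move (F : Graph → Set) (P : Position) : Position → Set where
  move : ∀ Rs₁ R Rs₂ {x y Rs} →
         regions P ≡ Rs₁ ++ [ R ] ++ Rs₂ →
         Connect (order (drawn P)) x y R Rs →
         F (subdividedEdge x y (drawn P)) →
         Move F P (position (subdividedEdge x y (drawn P)) (Rs₁ ++ Rs ++ Rs₂))

-- Two spots 0 and 1 with p and q tips, in a single region having one boundary
-- component around each spot.

start : ℕ → ℕ → Position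
start p q = position (graph 2 []) [ replicate p 0 ∷ replicate q 1 ∷ [] ]

-- `Nimber _⟶_ P n`: n is the least number which is not the nimber of an option
-- of P.  Being inductive, this only applies to positions from which all plays
-- are finite.

data Nimber {Pos : Set} (_⟶_ : Pos → Pos → Set) (P : Pos) (n : ℕ) : Set where
  mex : (∀ m → m < n → ∃[ Q ] P ⟶ Q × Nimber _⟶_ Q m) →
        (∀ Q → P ⟶ Q → ∃[ m ] Nimber _⟶_ Q m × m ≢ n) →
        Nimber _⟶_ P n

nimber-unique : ∀ {Pos : Set} {_⟶_ : Pos → Pos → Set} {P m n} →
                Nimber _⟶_ P m → Nimber _⟶_ P n → m ≡ n
nimber-unique {m = m} {n} (mex below avoid) (mex below′ avoid′) with <-cmp m n
... | tri≈ _ m≡n _ = m≡n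
... | tri< m<n _ _ with Q , P⟶Q , Qm ← below′ m m<n
                   with k , Qk , k≢m ← avoid Q P⟶Q
                   = contradiction (nimber-unique Qk Qm) k≢m
... | tri> _ _ n<m with Q , P⟶Q , Qn ← below n n<m
                   with k , Qk , k≢n ← avoid′ Q P⟶Q
                   = contradiction (nimber-unique Qk Qn) k≢n

-- Planar graphs of girth at least 4.  The graph of a position comes with a
-- plane drawing, hence is planar, and only the girth remains to be required.

𝒫₄ : Graph → Set
𝒫₄ = GirthAtLeast 4

{-# OPTIONS --safe #-}
module Submission where

-- A curve from x to y closes cycles of length dist(x, y) + 2, so the girth stays
-- at least 4 exactly when x and y are distinct and nonadjacent.  Hence the first
-- move must join the spots 0 and 1, through a new vertex 2, and leaves a single
-- region with boundary 0^(p-1) 2 1^(q-1) 2.  The reply joins the last tip at 0 to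
-- the last tip at 1, which leaves the regions 2 1^(q-2) 3 and 2 0^(p-2) 3.  In each
-- of them only 2 and 3 can be joined; this makes a dead region and one of the form
-- vⁿ 4, where any single tip at v can be joined to 4, after which every two tips
-- are at equal or adjacent vertices.  So exactly four more moves are played,
-- whatever the choices, and the reply has nimber 0.

open import Defs
open import Data.Fin.Base using (Fin; zero; suc; inject₁)
import Data.Fin.Properties as Fin
open import Data.Fin.Relation.Unary.Top using (view; ‵fromℕ; ‵inject₁)
open import Data.List.Base using (List; []; _∷_; [_]; _++_; length; lookup; replicate; map; concat; initLast; _∷ʳ′_)
open import Data.List.Membership.Propositional using (_∈_)
open import Data.List.Membership.Propositional.Properties using (∈-insert; ∈-++⁺ʳ; ∈-++⁻)
open import Data.List.Properties using (++-identityʳ; ++-assoc; map-++; length-++; length-++-comm; length-++-sucʳ; length-replicate; ∷-injective; ∷ʳ-injective)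
open import Data.List.Relation.Ternary.Interleaving.Propositional using ([])
open import Data.List.Relation.Unary.All as All using (All; []; _∷_)
open import Data.List.Relation.Unary.All.Properties using (++⁺; ++⁻; ++⁻ʳ; replicate⁺)
open import Data.List.Relation.Unary.Any using (here; there)
open import Data.Nat.Base using (ℕ; zero; suc; _+_; _∸_; _≤_; _<_; z≤n; s≤s; NonZero)
open import Data.Nat.ListAction using (sum)
open import Data.Nat.ListAction.Properties using (sum-++)
open import Data.Nat.Properties
open import Data.Product.Base using (_×_; _,_; ∃-syntax; proj₁; proj₂; map₂)
open import Data.Product.Properties using (,-injectiveˡ; ,-injectiveʳ) renaming (≡-dec to ×-≡-dec)
open import Data.Sum.Base using (_⊎_; inj₁; inj₂; swap)
open import Function.Base using (_∘_; case_of_)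
open import Relation.Binary.PropositionalEquality using (_≡_; _≢_; refl; sym; trans; cong; cong₂; subst; module ≡-Reasoning)
open import Relation.Nullary.Decidable using (Dec; yes; no; _⊎-dec_; _×-dec_; ¬?; map′; from-no)
open import Relation.Nullary.Negation.Core using (¬_; contradiction)

-- Adjacency and girth after inserting a subdivided edge

Adjacent : Graph → Vertex → Vertex → Set
Adjacent G u v = ∃[ i ] Joins (lookup (edges G) i) u v

adjacent? : ∀ G u v → Dec (Adjacent G u v)
adjacent? G u v = Fin.any? λ i → (lookup (edges G) i ≟ₑ (u , v)) ⊎-dec (lookup (edges G) i ≟ₑ (v , u))
  where _≟ₑ_ = ×-≡-dec _≟_ _≟_

adjacent-sym : ∀ {G u v} → Adjacent G u v → Adjacent G v u
adjacent-sym (i , j) = i , swap j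

-- `bounded` is what makes `order G` fresh: no edge ends there. Since adjacency is symmetric,
-- bounding one end bounds both.
record Sound (G : Graph) : Set where
  field
    girth   : 𝒫₄ G
    bounded : ∀ {u v} → Adjacent G u v → u < order G

-- A decidable form of the girth condition on a move. It speaks of old vertices only, so it survives
-- later moves.
record Joinable (G : Graph) (u v : Vertex) : Set where
  field
    left<       : u < order G
    right<      : v < order G
    distinct    : u ≢ v
    nonadjacent : ¬ Adjacent G u v

adjacent-subdivided : ∀ {x y G u v} → Adjacent G u v → Adjacent (subdividedEdge x y G) u v
adjacent-subdivided (i , j) = suc (suc i) , j

module _ {x y : Vertex} {G : Graph} where

  private
    w = order G
    H = subdividedEdge x y G

  adjacent-old : ∀ {u v} → u < w → v < w → Adjacent H u v → Adjacent G u v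
  adjacent-old u< v< (zero , inj₁ refl)        = contradiction refl (<⇒≢ v<)
  adjacent-old u< v< (zero , inj₂ refl)        = contradiction refl (<⇒≢ u<)
  adjacent-old u< v< (suc zero , inj₁ refl)    = contradiction refl (<⇒≢ u<)
  adjacent-old u< v< (suc zero , inj₂ refl)    = contradiction refl (<⇒≢ v<)
  adjacent-old u< v< (suc (suc i) , j)         = i , j

  joinable-subdivided : ∀ {u v} → Joinable G u v → Joinable H u v
  joinable-subdivided uv = record
    { left<       = m<n⇒m<1+n left<
    ; right<      = m<n⇒m<1+n right<
    ; distinct    = distinct
    ; nonadjacent = nonadjacent ∘ adjacent-old left< right<
    }
    where open Joinable uv

  module _ (sound : Sound G) (x< : x < w) (y< : y < w) where

    open Sound sound

    -- The fresh vertex has degree two. Naming the edge as well as the other end lets the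
    -- distinctness of the edges in a cycle be used.
    incident : ∀ i {u v} → u ≡ w → Joins (lookup (edges H) i) u v →
               (i ≡ zero × v ≡ x) ⊎ (i ≡ suc zero × v ≡ y)
    incident zero          refl (inj₁ eq)   = contradiction (,-injectiveˡ eq) (<⇒≢ x<)
    incident zero          refl (inj₂ refl) = inj₁ (refl , refl)
    incident (suc zero)    refl (inj₁ refl) = inj₂ (refl , refl)
    incident (suc zero)    refl (inj₂ eq)   = contradiction (,-injectiveʳ eq) (<⇒≢ y<)
    incident (suc (suc i)) refl j           = contradiction refl (<⇒≢ (bounded (i , j)))

    bounded-subdivided : ∀ {u v} → Adjacent H u v → u < suc w
    bounded-subdivided (zero , inj₁ refl)     = m<n⇒m<1+n x<
    bounded-subdivided (zero , inj₂ refl)     = n<1+n w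
    bounded-subdivided (suc zero , inj₁ refl) = n<1+n w
    bounded-subdivided (suc zero , inj₂ refl) = m<n⇒m<1+n y<
    bounded-subdivided (suc (suc i) , j)      = m<n⇒m<1+n (bounded (i , j))

    loop : ∀ {i u v} → u ≡ w → v ≡ w → ¬ Joins (lookup (edges H) i) u v
    loop {i} u≡w v≡w j with incident i u≡w j
    ... | inj₁ (_ , v≡x) = <⇒≢ x< (trans (sym v≡x) v≡w)
    ... | inj₂ (_ , v≡y) = <⇒≢ y< (trans (sym v≡y) v≡w)

    -- Two distinct edges at `w` are the two new ones, so `v` is both `x` and `y`.
    digon : ∀ {i j u v} → u ≡ w → i ≢ j →
            Joins (lookup (edges H) i) u v → Joins (lookup (edges H) j) u v → x ≡ y
    digon {i} {j} u≡w i≢j a b with incident i u≡w a | incident j u≡w b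
    ... | inj₁ (refl , _)   | inj₁ (refl , _)   = contradiction refl i≢j
    ... | inj₁ (_ , v≡x)    | inj₂ (_ , v≡y)    = trans (sym v≡x) v≡y
    ... | inj₂ (_ , v≡y)    | inj₁ (_ , v≡x)    = trans (sym v≡x) v≡y
    ... | inj₂ (refl , _)   | inj₂ (refl , _)   = contradiction refl i≢j

    -- The two edges at `w` use up the new edges; the third one is therefore old, and it joins `x`
    -- to `y`.
    triangle : ∀ {i j k u v t} → u ≡ w → i ≢ j → j ≢ k → k ≢ i →
               Joins (lookup (edges H) i) u v → Joins (lookup (edges H) j) v t →
               Joins (lookup (edges H) k) t u → Adjacent G x y
    triangle {i} {j} {k} u≡w i≢j j≢k k≢i a b c with incident i u≡w a | incident k u≡w (swap c) | j
    ... | inj₁ (refl , _)    | inj₁ (refl , _)    | _           = contradiction refl k≢i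
    ... | inj₂ (refl , _)    | inj₂ (refl , _)    | _           = contradiction refl k≢i
    ... | inj₁ (refl , _)    | inj₂ _             | zero        = contradiction refl i≢j
    ... | inj₁ _             | inj₂ (refl , _)    | suc zero    = contradiction refl j≢k
    ... | inj₁ (_ , refl)    | inj₂ (_ , refl)    | suc (suc j) = j , b
    ... | inj₂ _             | inj₁ (refl , _)    | zero        = contradiction refl j≢k
    ... | inj₂ (refl , _)    | inj₁ _             | suc zero    = contradiction refl i≢j
    ... | inj₂ (_ , refl)    | inj₁ (_ , refl)    | suc (suc j) = j , swap b

    old-edge : ∀ i {u v} → u ≢ w → v ≢ w → Joins (lookup (edges H) i) u v →
               ∃[ j ] i ≡ suc (suc j) × Joins (lookup (edges G) j) u v
    old-edge zero          u≢w v≢w (inj₁ refl) = contradiction refl v≢w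
    old-edge zero          u≢w v≢w (inj₂ refl) = contradiction refl u≢w
    old-edge (suc zero)    u≢w v≢w (inj₁ refl) = contradiction refl u≢w
    old-edge (suc zero)    u≢w v≢w (inj₂ refl) = contradiction refl v≢w
    old-edge (suc (suc i)) u≢w v≢w j           = i , refl , j

    -- A cycle avoiding `w` is already a cycle of `G`. One through `w` is turned until it starts at
    -- `w`, and then `loop`, `digon` and `triangle` exclude the lengths 1, 2 and 3.
    girth-subdivided : x ≢ y → ¬ Adjacent G x y → 𝒫₄ H
    girth-subdivided x≢y ¬xy {k} c with Fin.any? (λ i → Cycle.vertex c (inject₁ i) ≟ w)
    ... | no avoids = girth record
            { nonZero          = nonZero
            ; vertex           = vertex
            ; edge             = λ i → proj₁ (old i)
            ; joins            = λ i → proj₂ (proj₂ (old i))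
            ; closed           = closed
            ; vertex-injective = vertex-injective
            ; edge-injective   = λ {i} {j} eq → edge-injective
                (trans (proj₁ (proj₂ (old i)))
                       (trans (cong (λ l → suc (suc l)) eq) (sym (proj₁ (proj₂ (old j))))))
            }
      where
      open Cycle c
      start≢w : ∀ k {{_ : NonZero k}} {vertex : Fin (suc k) → Vertex} →
                ¬ (∃[ i ] vertex (inject₁ i) ≡ w) → vertex zero ≢ w
      start≢w (suc k) avoids eq = avoids (zero , eq)

      ≢w : ∀ i → vertex i ≢ w
      -- The last vertex is the only one that `inject₁` misses; `closed` identifies it with the
      -- first.
      ≢w i with view i
      ... | ‵fromℕ     = start≢w k {vertex = vertex} avoids ∘ trans (sym closed)
      ... | ‵inject₁ i = avoids ∘ (i ,_)

      old = λ i → old-edge (edge i) (≢w (inject₁ i)) (≢w (suc i)) (joins i)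
    ... | yes (i , i≡w) = through k c i i≡w
      where
      through : ∀ k (c : Cycle H k) i → Cycle.vertex c (inject₁ i) ≡ w → 4 ≤ k
      through 1 c zero v≡w = contradiction (joins zero) (loop {edge zero} v≡w (trans closed v≡w))
        where open Cycle c
      through 2 c i v≡w = contradiction (digon′ i v≡w) x≢y
        where
        open Cycle c
        j₁ = subst (Joins (lookup (edges H) (edge (suc zero))) (vertex (suc zero))) closed (joins (suc zero))
        e₀₁ = λ eq → case edge-injective {zero} {suc zero} eq of λ ()
        digon′ : ∀ i → vertex (inject₁ i) ≡ w → x ≡ y
        digon′ zero       v≡w = digon v≡w e₀₁ (joins zero) (swap j₁)
        digon′ (suc zero) v≡w = digon v≡w e₀₁ (swap (joins zero)) j₁
      through 3 c i v≡w = contradiction (triangle′ i v≡w) ¬xy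
        where
        open Cycle c
        j₀ = joins zero
        j₁ = joins (suc zero)
        j₂ = subst (Joins (lookup (edges H) (edge (suc (suc zero)))) (vertex (suc (suc zero)))) closed (joins (suc (suc zero)))
        e₀₁ = λ eq → case edge-injective {zero} {suc zero} eq of λ ()
        e₁₂ = λ eq → case edge-injective {suc zero} {suc (suc zero)} eq of λ ()
        e₂₀ = λ eq → case edge-injective {suc (suc zero)} {zero} eq of λ ()
        triangle′ : ∀ i → vertex (inject₁ i) ≡ w → Adjacent G x y
        triangle′ zero             v≡w = triangle v≡w e₀₁ e₁₂ e₂₀ j₀ j₁ j₂
        triangle′ (suc zero)       v≡w = triangle v≡w e₁₂ e₂₀ e₀₁ j₁ j₂ j₀
        triangle′ (suc (suc zero)) v≡w = triangle v≡w e₂₀ e₀₁ e₁₂ j₂ j₀ j₁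
      through (suc (suc (suc (suc k)))) _ _ _ = s≤s (s≤s (s≤s (s≤s z≤n)))

    sound-subdivided : x ≢ y → ¬ Adjacent G x y → Sound H
    sound-subdivided x≢y ¬xy = record
      { girth = girth-subdivided x≢y ¬xy ; bounded = bounded-subdivided }

  -- If `x` and `y` coincided, the two new edges would be parallel.
  girth⇒distinct : x < w → 𝒫₄ H → x ≢ y
  girth⇒distinct x< girth refl = contradiction (girth cycle) λ { (s≤s (s≤s ())) }
    where
    cycle : Cycle H 2
    cycle = record
      { vertex           = λ { zero → x ; (suc zero) → w ; (suc (suc zero)) → x }
      ; edge             = λ { zero → zero ; (suc zero) → suc zero }
      ; joins            = λ { zero → inj₁ refl ; (suc zero) → inj₁ refl }
      ; closed           = refl
      ; vertex-injective = λ
          { {zero}     {zero}     _  → refl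
          ; {zero}     {suc zero} eq → contradiction eq (<⇒≢ x<)
          ; {suc zero} {zero}     eq → contradiction (sym eq) (<⇒≢ x<)
          ; {suc zero} {suc zero} _  → refl
          }
      ; edge-injective   = λ
          { {zero}     {zero}     _ → refl
          ; {zero}     {suc zero} ()
          ; {suc zero} {zero}     ()
          ; {suc zero} {suc zero} _ → refl
          }
      }

  -- An old edge between `x` and `y` would close a triangle with the two new edges.
  girth⇒nonadjacent : x < w → y < w → 𝒫₄ H → ¬ Adjacent G x y
  girth⇒nonadjacent x< y< girth (i , j) = contradiction (girth cycle) λ { (s≤s (s≤s (s≤s ()))) }
    where
    x≢y = girth⇒distinct x< girth
    cycle : Cycle H 3
    cycle = record
      { vertex           = λ { zero → x ; (suc zero) → w ; (suc (suc zero)) → y ; (suc (suc (suc zero))) → x }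
      ; edge             = λ { zero → zero ; (suc zero) → suc zero ; (suc (suc zero)) → suc (suc i) }
      ; joins            = λ { zero → inj₁ refl ; (suc zero) → inj₁ refl ; (suc (suc zero)) → swap j }
      ; closed           = refl
      ; vertex-injective = λ
          { {zero}           {zero}           _  → refl
          ; {zero}           {suc zero}       eq → contradiction eq (<⇒≢ x<)
          ; {zero}           {suc (suc zero)} eq → contradiction eq x≢y
          ; {suc zero}       {zero}           eq → contradiction (sym eq) (<⇒≢ x<)
          ; {suc zero}       {suc zero}       _  → refl
          ; {suc zero}       {suc (suc zero)} eq → contradiction (sym eq) (<⇒≢ y<)
          ; {suc (suc zero)} {zero}           eq → contradiction (sym eq) x≢y
          ; {suc (suc zero)} {suc zero}       eq → contradiction eq (<⇒≢ y<)
          ; {suc (suc zero)} {suc (suc zero)} _  → refl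
          }
      ; edge-injective   = λ
          { {zero}           {zero}           _ → refl
          ; {zero}           {suc zero}       ()
          ; {zero}           {suc (suc zero)} ()
          ; {suc zero}       {zero}           ()
          ; {suc zero}       {suc zero}       _ → refl
          ; {suc zero}       {suc (suc zero)} ()
          ; {suc (suc zero)} {zero}           ()
          ; {suc (suc zero)} {suc zero}       ()
          ; {suc (suc zero)} {suc (suc zero)} _ → refl
          }
      }

  joinable⇒sound : Sound G → Joinable G x y → Sound H
  joinable⇒sound sound xy = sound-subdivided sound left< right< distinct nonadjacent
    where open Joinable xy

  girth⇒joinable : x < w → y < w → 𝒫₄ H → Joinable G x y
  girth⇒joinable x< y< girth = record
    { left<       = x<
    ; right<      = y<
    ; distinct    = girth⇒distinct x< girth
    ; nonadjacent = girth⇒nonadjacent x< y< girth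
    }

joinable? : ∀ G u v → Dec (Joinable G u v)
joinable? G u v = map′
  (λ { (l , r , d , n) → record { left< = l ; right< = r ; distinct = d ; nonadjacent = n } })
  (λ uv → let open Joinable uv in left< , right< , distinct , nonadjacent)
  (u <? order G ×-dec v <? order G ×-dec ¬? (u ≟ v) ×-dec ¬? (adjacent? G u v))

-- Existence of nimbers

least-failure : {D : ℕ → Set} → (∀ m → Dec (D m)) → ∀ b →
                (∀ m → m < b → D m) ⊎ (∃[ m ] m < b × ¬ D m × (∀ k → k < m → D k))
least-failure D? zero    = inj₁ λ _ ()
least-failure D? (suc b) with least-failure D? b
... | inj₂ (m , m<b , ¬Dm , below) = inj₂ (m , m<n⇒m<1+n m<b , ¬Dm , below)
... | inj₁ below with D? b
...   | no ¬Db = inj₂ (b , n<1+n b , ¬Db , below)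
...   | yes Db = inj₁ λ m m<1+b → case m<1+n⇒m<n∨m≡n m<1+b of λ
          { (inj₁ m<b) → below m m<b ; (inj₂ refl) → Db }

-- To find a mex constructively, it must be decidable whether some option has a given nimber.
-- `option?` provides this by search, and only for properties that are decided on actual options.
module _ {Pos : Set} {_⟶_ : Pos → Pos → Set}
         (Inv : Pos → Set) (rank : Pos → ℕ)
         (preserved : ∀ {P Q} → Inv P → P ⟶ Q → Inv Q)
         (descends : ∀ {P Q} → Inv P → P ⟶ Q → rank Q < rank P)
         (option? : ∀ {P} {C : Pos → Set} → Inv P → (∀ {Q} → P ⟶ Q → Dec (C Q)) →
                    Dec (∃[ Q ] P ⟶ Q × C Q))
         where

  -- The bound on the nimber makes the search for the mex finite.
  bounded-nimber : ∀ r {P} → Inv P → rank P < r → ∃[ n ] n < r × Nimber _⟶_ P n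
  bounded-nimber (suc r) {P} inv (s≤s rank≤r) with least-failure taken? (suc r)
    where
    option-nimber : ∀ {Q} → P ⟶ Q → ∃[ n ] n < r × Nimber _⟶_ Q n
    option-nimber st = bounded-nimber r (preserved inv st) (<-≤-trans (descends inv st) rank≤r)

    taken? : ∀ m → Dec (∃[ Q ] P ⟶ Q × Nimber _⟶_ Q m)
    taken? m = option? inv λ st → case option-nimber st of λ (n , _ , Qn) →
      map′ (λ { refl → Qn }) (nimber-unique Qn) (n ≟ m)
  -- The values up to `r` cannot all be taken: by induction every option has a nimber below `r`.
  ... | inj₁ all with Q , st , Qr ← all r (n<1+n r)
                 with n , n<r , Qn ← bounded-nimber r (preserved inv st) (<-≤-trans (descends inv st) rank≤r)
                 = contradiction (nimber-unique Qn Qr) (<⇒≢ n<r)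
  ... | inj₂ (m , m<r , ¬Dm , below) = m , m<r , mex below λ Q st →
    case bounded-nimber r (preserved inv st) (<-≤-trans (descends inv st) rank≤r) of λ
      (n , _ , Qn) → n , Qn , λ { refl → ¬Dm (Q , st , Qn) }

  nimber-exists : ∀ {P} → Inv P → ∃[ n ] Nimber _⟶_ P n
  nimber-exists inv = map₂ proj₂ (bounded-nimber _ inv (n<1+n _))

-- Moves in a connected graph

singleton-split : ∀ {A : Set} {a : A} xs {b ys} → [ a ] ≡ xs ++ b ∷ ys → xs ≡ [] × a ≡ b × ys ≡ []
singleton-split []           refl = refl , refl , refl
singleton-split (_ ∷ [])     ()
singleton-split (_ ∷ _ ∷ _)  ()

append-cons≢[] : ∀ {A : Set} (xs : List A) {y ys} → xs ++ y ∷ ys ≢ []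
append-cons≢[] []      ()
append-cons≢[] (_ ∷ _) ()

-- With one boundary component, `different` is impossible and no other components are left to be
-- distributed between the two halves.
connect-single : ∀ {w x y W Rs} → Connect w x y [ W ] Rs →
  ∃[ A ] ∃[ B ] ∃[ C ] W ≡ A ++ x ∷ B ++ y ∷ C × Rs ≡ [ B ++ [ w ] ] ∷ [ C ++ A ++ [ w ] ] ∷ []
connect-single (same Cs₁ A B C Cs₂ eq i) with singleton-split Cs₁ eq
connect-single (same _ A B C _ eq []) | refl , W≡ , refl = A , B , C , W≡ , refl
connect-single (different Cs₁ A B Cs₂ C D Cs₃ eq) with singleton-split Cs₁ eq
... | _ , _ , none = contradiction none (append-cons≢[] Cs₂)

-- The form that moves take in tame positions: a split of one word, with the girth condition
-- replaced by `Joinable`.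
data Cut (P : Position) : Position → Set where
  cut : ∀ Rs₁ A x B y C Rs₂ → let w = order (drawn P) in
        regions P ≡ Rs₁ ++ [ A ++ x ∷ B ++ y ∷ C ] ∷ Rs₂ →
        Joinable (drawn P) x y →
        Cut P (position (subdividedEdge x y (drawn P))
                        (Rs₁ ++ [ B ++ [ w ] ] ∷ [ C ++ A ++ [ w ] ] ∷ Rs₂))

-- Once the graph is connected, every region has a single boundary component.
record Tame (P : Position) : Set where
  field
    sound : Sound (drawn P)
    words : All (λ R → ∃[ W ] R ≡ [ W ] × All (_< order (drawn P)) W) (regions P)

move⇒cut : ∀ {P Q} → Tame P → Move 𝒫₄ P Q → Cut P Q
move⇒cut {P} tame (move Rs₁ R Rs₂ {x} {y} eq conn girth)
  with W , refl , W< ← All.head (++⁻ʳ Rs₁ (subst (All _) eq (Tame.words tame)))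
  with A , B , C , refl , refl ← connect-single conn
  with x< ∷ <₂ ← ++⁻ʳ A W<
  with y< ∷ _ ← ++⁻ʳ B <₂
  = cut Rs₁ A x B y C Rs₂ eq (girth⇒joinable x< y< girth)

cut⇒move : ∀ {P Q} → Tame P → Cut P Q → Move 𝒫₄ P Q
cut⇒move tame (cut Rs₁ A x B y C Rs₂ eq xy) =
  move Rs₁ _ Rs₂ eq (same [] A B C [] refl [])
       (Sound.girth (joinable⇒sound (Tame.sound tame) xy))

tame-cut : ∀ {P Q} → Tame P → Cut P Q → Tame Q
tame-cut {P} tame (cut Rs₁ A x B y C Rs₂ eq xy)
  with ws₁ , (_ , refl , W<) ∷ ws₂ ← ++⁻ Rs₁ (subst (All _) eq (Tame.words tame))
  with A< , _ ∷ <₂ ← ++⁻ A W<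
  with B< , _ ∷ C< ← ++⁻ B <₂
  = record
  { sound = joinable⇒sound (Tame.sound tame) xy
  ; words = ++⁺ (All.map weaken ws₁)
      ( (_ , refl , ++⁺ (All.map m<n⇒m<1+n B<) fresh)
      ∷ (_ , refl , ++⁺ (All.map m<n⇒m<1+n C<) (++⁺ (All.map m<n⇒m<1+n A<) fresh))
      ∷ All.map weaken ws₂)
  }
  where
  w = order (drawn P)
  fresh : All (_< suc w) [ w ]
  fresh = n<1+n w ∷ []
  weaken : ∀ {R : Region} → ∃[ W ] R ≡ [ W ] × All (_< w) W → ∃[ W ] R ≡ [ W ] × All (_< suc w) W
  weaken (W , R≡ , W<) = W , R≡ , All.map m<n⇒m<1+n W<

-- Subtracting one for each region makes the sum fall when a region is split. Both halves of a cut
-- contain a new tip, so the truncation is harmless for them.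
tips : Region → ℕ
tips R = length (concat R) ∸ 1

-- A cut keeps the number of tips and adds one region.
rank : Position → ℕ
rank P = sum (map tips (regions P))

rank-cut : ∀ {P Q} → Cut P Q → rank Q < rank P
rank-cut {P} (cut Rs₁ A x B y C Rs₂ eq xy) = ≤-reflexive (sym (begin
  sum (map tips (regions P))                              ≡⟨ cong (sum ∘ map tips) eq ⟩
  sum (map tips (Rs₁ ++ [ A ++ x ∷ B ++ y ∷ C ] ∷ Rs₂))   ≡⟨ sum-tips Rs₁ ⟩
  sum (map tips Rs₁) + (tips [ A ++ x ∷ B ++ y ∷ C ] + s₂) ≡⟨ cong (λ t → sum (map tips Rs₁) + (t + s₂)) count ⟩
  sum (map tips Rs₁) + suc (t₁ + t₂ + s₂)                 ≡⟨ +-suc _ _ ⟩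
  suc (sum (map tips Rs₁) + (t₁ + t₂ + s₂))               ≡⟨ cong (λ t → suc (sum (map tips Rs₁) + t)) (+-assoc t₁ t₂ s₂) ⟩
  suc (sum (map tips Rs₁) + (t₁ + (t₂ + s₂)))             ≡⟨ cong suc (sum-tips Rs₁) ⟨
  suc (sum (map tips (Rs₁ ++ [ B ++ [ w ] ] ∷ [ C ++ A ++ [ w ] ] ∷ Rs₂))) ∎))
  where
  open ≡-Reasoning
  w = order (drawn P)
  s₂ = sum (map tips Rs₂)
  t₁ = tips [ B ++ [ w ] ]
  t₂ = tips [ C ++ A ++ [ w ] ]

  sum-tips : ∀ Rs {Rs′} → sum (map tips (Rs ++ Rs′)) ≡ sum (map tips Rs) + sum (map tips Rs′)
  sum-tips Rs {Rs′} = trans (cong sum (map-++ tips Rs Rs′)) (sum-++ (map tips Rs) (map tips Rs′))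

  tips-single : ∀ (W : Boundary) → tips [ W ] ≡ length W ∸ 1
  tips-single W = cong (λ V → length V ∸ 1) (++-identityʳ W)

  tips-snoc : ∀ (W : Boundary) → tips [ W ++ [ w ] ] ≡ length W
  tips-snoc W = begin
    tips [ W ++ [ w ] ]      ≡⟨ tips-single (W ++ [ w ]) ⟩
    length (W ++ [ w ]) ∸ 1  ≡⟨ cong (_∸ 1) (length-++-comm W [ w ]) ⟩
    length W                 ∎

  count : tips [ A ++ x ∷ B ++ y ∷ C ] ≡ suc (t₁ + t₂)
  count = begin
    -- Rotating the word brings `x` to the front, where `∸ 1` removes it by computation.
    tips [ A ++ x ∷ B ++ y ∷ C ]            ≡⟨ tips-single (A ++ x ∷ B ++ y ∷ C) ⟩
    length (A ++ x ∷ B ++ y ∷ C) ∸ 1        ≡⟨ cong (_∸ 1) (length-++-comm A (x ∷ B ++ y ∷ C)) ⟩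
    length ((B ++ y ∷ C) ++ A)              ≡⟨ cong length (++-assoc B (y ∷ C) A) ⟩
    length (B ++ y ∷ C ++ A)                ≡⟨ length-++-sucʳ B y (C ++ A) ⟩
    suc (length (B ++ C ++ A))              ≡⟨ cong suc (length-++ B) ⟩
    suc (length B + length (C ++ A))        ≡⟨ cong₂ (λ m n → suc (m + n)) (tips-snoc B) (tips-snoc (C ++ A)) ⟨
    suc (t₁ + tips [ (C ++ A) ++ [ w ] ])   ≡⟨ cong (λ W → suc (t₁ + tips [ W ])) (++-assoc C A [ w ]) ⟩
    suc (t₁ + t₂)                           ∎

-- Exhaustive search through the cuts

split? : ∀ {A : Set} {D : List A → A → List A → Set} xs →
         (∀ ys z zs → xs ≡ ys ++ z ∷ zs → Dec (D ys z zs)) →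
         Dec (∃[ ys ] ∃[ z ] ∃[ zs ] xs ≡ ys ++ z ∷ zs × D ys z zs)
split? [] D? = no λ { ([] , _ , _ , () , _) ; (_ ∷ _ , _ , _ , () , _) }
split? {D = D} (x ∷ xs) D?
  with D? [] x xs refl
     | split? {D = D ∘ (x ∷_)} xs (λ ys z zs eq → D? (x ∷ ys) z zs (cong (x ∷_) eq))
... | yes d | _ = yes ([] , x , xs , refl , d)
... | no _  | yes (ys , z , zs , eq , d) = yes (x ∷ ys , z , zs , cong (x ∷_) eq , d)
... | no ¬d | no ¬ds = no λ
  { ([] , _ , _ , refl , d)            → ¬d d
  ; (_ ∷ ys , z , zs , refl , d)       → ¬ds (ys , z , zs , refl , d)
  }

-- Three nested searches choose the region, the first tip and the second tip. Joinability is decided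
-- before the property, which is decided only for genuine cuts.
cut? : ∀ {P} {C : Position → Set} → Tame P → (∀ {Q} → Cut P Q → Dec (C Q)) → Dec (∃[ Q ] Cut P Q × C Q)
cut? {P} {F} tame F? = map′
  (λ { (Rs₁ , _ , Rs₂ , eq , A , x , B , y , C , refl , xy , f) → _ , cut Rs₁ A x B y C Rs₂ eq xy , f })
  (λ { (_ , cut Rs₁ A x B y C Rs₂ eq xy , f) → Rs₁ , _ , Rs₂ , eq , A , x , B , y , C , refl , xy , f })
  (split? (regions P) region?)
  where
  G = drawn P
  w = order G

  Option : (Rs₁ Rs₂ : List Region) → Boundary → Vertex → Boundary → Vertex → Boundary → Set
  Option Rs₁ Rs₂ A x B y C = Joinable G x y ×
    F (position (subdividedEdge x y G) (Rs₁ ++ [ B ++ [ w ] ] ∷ [ C ++ A ++ [ w ] ] ∷ Rs₂))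

  option? : ∀ Rs₁ Rs₂ A x B y C → regions P ≡ Rs₁ ++ [ A ++ x ∷ B ++ y ∷ C ] ∷ Rs₂ →
            Dec (Option Rs₁ Rs₂ A x B y C)
  option? Rs₁ Rs₂ A x B y C eq with joinable? G x y
  ... | no ¬xy = no (¬xy ∘ proj₁)
  ... | yes xy = map′ (xy ,_) proj₂ (F? (cut Rs₁ A x B y C Rs₂ eq xy))

  region? : ∀ Rs₁ R Rs₂ → regions P ≡ Rs₁ ++ R ∷ Rs₂ →
    Dec (∃[ A ] ∃[ x ] ∃[ B ] ∃[ y ] ∃[ C ] R ≡ [ A ++ x ∷ B ++ y ∷ C ] × Option Rs₁ Rs₂ A x B y C)
  region? Rs₁ R Rs₂ eq with W , refl , _ ← All.head (++⁻ʳ Rs₁ (subst (All _) eq (Tame.words tame))) = map′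
    (λ { (A , x , _ , refl , B , y , C , refl , d) → A , x , B , y , C , refl , d })
    (λ { (A , x , B , y , C , refl , d) → A , x , _ , refl , B , y , C , refl , d })
    (split? {D = λ A x E → ∃[ B ] ∃[ y ] ∃[ C ] E ≡ B ++ y ∷ C × Option Rs₁ Rs₂ A x B y C} W
      λ { A x E refl → split? {D = Option Rs₁ Rs₂ A x} E λ { B y C refl → option? Rs₁ Rs₂ A x B y C eq } })

-- Supplies a nimber for the position after the opening, whose value is never computed: it only has
-- to differ from 0.
tame-nimber : ∀ {P} → Tame P → ∃[ n ] Nimber (Move 𝒫₄) P n
tame-nimber = nimber-exists Tame rank
  (λ tame m → tame-cut tame (move⇒cut tame m))
  (λ tame m → rank-cut (move⇒cut tame m))
  (λ tame F? → map′ (λ (Q , c , f) → Q , cut⇒move tame c , f)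
                    (λ (Q , m , f) → Q , move⇒cut tame m , f)
                    (cut? tame (F? ∘ cut⇒move tame)))

-- Positions in which the number of remaining moves does not depend on the play

-- The number counts the moves left inside the region. `suc n` keeps a tip at `v` available for the
-- last move. In `twice`, the inequalities ensure that `v` is not adjacent to the vertex created by
-- joining `u` to `w`.
data Lasts (G : Graph) : Region → ℕ → Set where
  stuck : ∀ {W} → (∀ {u v} → u ∈ W → v ∈ W → u ≡ v ⊎ Adjacent G u v) →
          Lasts G [ W ] 0
  once  : ∀ {v w} n → Joinable G v w →
          Lasts G [ replicate (suc n) v ++ [ w ] ] 1
  twice : ∀ {u v w} n → Joinable G u w → Adjacent G u v → Adjacent G v w → u ≢ v → v ≢ w →
          Lasts G [ u ∷ replicate (suc n) v ++ [ w ] ] 2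

-- Both new edges end at a fresh vertex, so adjacency between old vertices does not change. Hence a
-- move in one region leaves the counts of the others alone.
lasts-subdivided : ∀ {x y G R k} → Lasts G R k → Lasts (subdividedEdge x y G) R k
lasts-subdivided (stuck close) = stuck λ u∈ v∈ → case close u∈ v∈ of λ
  { (inj₁ u≡v) → inj₁ u≡v ; (inj₂ uv) → inj₂ (adjacent-subdivided uv) }
lasts-subdivided (once n vw) = once n (joinable-subdivided vw)
lasts-subdivided (twice n uw uv vw u≢v v≢w) =
  twice n (joinable-subdivided uw) (adjacent-subdivided uv) (adjacent-subdivided vw) u≢v v≢w

all-same : ∀ {v : Vertex} {xs} → All (_≡ v) xs → xs ≡ replicate (length xs) v
all-same []           = refl
all-same (refl ∷ xs≡) = cong (_ ∷_) (all-same xs≡)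

snoc-split : ∀ {W w} D {y : Vertex} C → W ++ [ w ] ≡ D ++ y ∷ C →
             (C ≡ [] × w ≡ y × W ≡ D) ⊎ (∃[ C′ ] W ≡ D ++ y ∷ C′)
snoc-split {W} D {y} C eq with initLast C
... | []      with W≡D , w≡y ← ∷ʳ-injective W D eq = inj₁ (refl , w≡y , W≡D)
... | C′ ∷ʳ′ c = inj₂ (C′ , proj₁ (∷ʳ-injective W (D ++ y ∷ C′) (trans eq (sym (++-assoc D (y ∷ C′) [ c ])))))

stuck-block : ∀ {G v w B} → Adjacent G v w → All (_≡ v) B → Lasts G [ B ++ [ w ] ] 0
stuck-block {G} {v} {w} {B} vw B≡ = stuck λ s∈ t∈ → close (tip s∈) (tip t∈)
  where
  tip : ∀ {s} → s ∈ B ++ [ w ] → s ≡ v ⊎ s ≡ w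
  tip s∈ with ∈-++⁻ B s∈
  ... | inj₁ s∈B        = inj₁ (All.lookup B≡ s∈B)
  ... | inj₂ (here s≡w) = inj₂ s≡w

  close : ∀ {s t} → s ≡ v ⊎ s ≡ w → t ≡ v ⊎ t ≡ w → s ≡ t ⊎ Adjacent G s t
  close (inj₁ refl) (inj₁ refl) = inj₁ refl
  close (inj₁ refl) (inj₂ refl) = inj₂ vw
  close (inj₂ refl) (inj₁ refl) = inj₂ (adjacent-sym {G} vw)
  close (inj₂ refl) (inj₂ refl) = inj₁ refl

-- Distinct vertices cannot both come from the block of `v`, so the second tip is the final `w`.
block-split : ∀ {v w x y : Vertex} n A B C → x ≢ y → replicate n v ++ [ w ] ≡ A ++ x ∷ B ++ y ∷ C →
              C ≡ [] × x ≡ v × w ≡ y × All (_≡ v) A × All (_≡ v) B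
block-split {v} {w} {x} {y} n A B C x≢y eq
  with snoc-split (A ++ x ∷ B) C (trans eq (sym (++-assoc A (x ∷ B) (y ∷ C))))
... | inj₁ (C≡ , w≡y , vs≡) with A≡ , x≡v ∷ B≡ ← ++⁻ A (subst (All (_≡ v)) vs≡ (replicate⁺ n refl)) =
  C≡ , x≡v , w≡y , A≡ , B≡
... | inj₂ (C′ , vs≡)
  with AxB≡ , y≡v ∷ _ ← ++⁻ (A ++ x ∷ B) (subst (All (_≡ v)) vs≡ (replicate⁺ n refl))
  with x≡v ∷ _ ← ++⁻ʳ A AxB≡ = contradiction (trans x≡v (sym y≡v)) x≢y

module _ {G : Graph} (sound : Sound G) {x y : Vertex} (xy : Joinable G x y) where

  open Sound sound
  open Joinable xy

  private
    o = order G
    H = subdividedEdge x y G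

    xo : Adjacent H x o
    xo = zero , inj₁ refl

  lasts-cut : ∀ {R k} A B C → Lasts G R k → R ≡ [ A ++ x ∷ B ++ y ∷ C ] →
    ∃[ k₁ ] ∃[ k₂ ] k ≡ suc (k₁ + k₂) × Lasts H [ B ++ [ o ] ] k₁ × Lasts H [ C ++ A ++ [ o ] ] k₂
  lasts-cut A B C (stuck close) refl
    with close (∈-insert A) (∈-++⁺ʳ A (there (∈-insert B)))
  ... | inj₁ x≡y = contradiction x≡y distinct
  ... | inj₂ a   = contradiction a nonadjacent
  lasts-cut A B C (once n vw) eq
    with refl , refl , refl , A≡ , B≡ ← block-split (suc n) A B C distinct (proj₁ (∷-injective eq))
    = 0 , 0 , refl , stuck-block xo B≡ , stuck-block xo A≡
  lasts-cut [] B C (twice {v = v} n uw uv vw u≢v v≢w) eq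
    with refl , eq′ ← ∷-injective (proj₁ (∷-injective eq))
    with snoc-split {replicate (suc n) v} B C eq′
  -- Here `u` is joined to `w`: one half has the whole block of `v` and the new vertex, the other
  -- has a new tip alone.
  ... | inj₁ (refl , refl , refl) = 1 , 0 , refl
      , once n (record { left<       = m<n⇒m<1+n (bounded vw)
                       ; right<      = n<1+n o
                       ; distinct    = <⇒≢ (bounded vw)
                       ; nonadjacent = apart })
      , stuck-block xo []
    where
    apart : ¬ Adjacent H _ o
    -- The neighbours of the new vertex are just `u` and `w`, and `v` is neither.
    apart (i , j) with incident sound left< right< i refl (swap j)
    ... | inj₁ (_ , v≡x) = u≢v (sym v≡x)
    ... | inj₂ (_ , v≡y) = v≢w v≡y
  ... | inj₂ (_ , vs≡) with y≡v ∷ _ ← ++⁻ʳ B (subst (All (_≡ _)) vs≡ (replicate⁺ (suc n) refl)) =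
    contradiction (subst (Adjacent G x) (sym y≡v) uv) nonadjacent
  lasts-cut (_ ∷ A) B C (twice n uw uv vw u≢v v≢w) eq
    with refl , eq′ ← ∷-injective (proj₁ (∷-injective eq))
    -- A first tip inside the block forces the adjacent pair `v`, `w`.
    with refl , refl , refl , _ ← block-split (suc n) A B C distinct eq′
    = contradiction vw nonadjacent

data Total (G : Graph) : List Region → ℕ → Set where
  []  : Total G [] 0
  _∷_ : ∀ {R Rs k n} → Lasts G R k → Total G Rs n → Total G (R ∷ Rs) (k + n)

total-subdivided : ∀ {x y G Rs n} → Total G Rs n → Total (subdividedEdge x y G) Rs n
total-subdivided []      = []
total-subdivided (l ∷ t) = lasts-subdivided l ∷ total-subdivided t

-- The region that is cut loses exactly one from its count, by `lasts-cut`, and the others keep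
-- theirs.
total-cut : ∀ {P Q n} → Sound (drawn P) → Total (drawn P) (regions P) n → Cut P Q →
            ∃[ m ] n ≡ suc m × Total (drawn Q) (regions Q) m
total-cut {P} sound total (cut Rs₁ A x B y C Rs₂ eq xy) = go Rs₁ (subst (λ Rs → Total _ Rs _) eq total)
  where
  w = order (drawn P)
  go : ∀ Rs₁ {n} → Total (drawn P) (Rs₁ ++ [ A ++ x ∷ B ++ y ∷ C ] ∷ Rs₂) n →
       ∃[ m ] n ≡ suc m × Total (subdividedEdge x y (drawn P))
                                (Rs₁ ++ [ B ++ [ w ] ] ∷ [ C ++ A ++ [ w ] ] ∷ Rs₂) m
  go [] (_∷_ {n = n} l t) with k₁ , k₂ , refl , l₁ , l₂ ← lasts-cut sound xy A B C l refl =
    k₁ + (k₂ + n) , cong suc (+-assoc k₁ k₂ n) , l₁ ∷ l₂ ∷ total-subdivided t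
  go (_ ∷ Rs₁) (_∷_ {k = k} l t) with m , refl , t′ ← go Rs₁ t =
    k + m , +-suc k m , lasts-subdivided l ∷ t′

total-option : ∀ {P n} → n ≢ 0 → Total (drawn P) (regions P) n → ∃[ Q ] Cut P Q
total-option {P} n≢0 total = go [] refl n≢0 total
  where
  go : ∀ Rs₁ {Rs n} → regions P ≡ Rs₁ ++ Rs → n ≢ 0 → Total (drawn P) Rs n → ∃[ Q ] Cut P Q
  go Rs₁ eq n≢0 []                       = contradiction refl n≢0
  go Rs₁ eq n≢0 (_∷_ {R} {Rs} (stuck _) t) =
    go (Rs₁ ++ [ R ]) (trans eq (sym (++-assoc Rs₁ [ R ] Rs))) n≢0 t
  -- In a region that is not stuck, the first tip can be joined to the last.
  go Rs₁ eq n≢0 (once n vw ∷ _)          = _ , cut Rs₁ [] _ (replicate n _) _ [] _ eq vw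
  go Rs₁ eq n≢0 (twice n uw _ _ _ _ ∷ _) = _ , cut Rs₁ [] _ (replicate (suc n) _) _ [] _ eq uw

parity : ℕ → ℕ
parity zero    = 0
parity (suc n) = 1 ∸ parity n

-- By induction all options have the same nimber, `parity n`, which is 0 or 1; the mex of a single
-- such value is the other one.
total-nimber : ∀ n {P} → Tame P → Total (drawn P) (regions P) n → Nimber (Move 𝒫₄) P (parity n)
total-nimber zero    tame total = mex (λ _ ()) λ Q st →
  case total-cut (Tame.sound tame) total (move⇒cut tame st) of λ ()
total-nimber (suc n) {P} tame total = mex below avoid
  where
  option : ∀ {Q} → Cut P Q → Nimber (Move 𝒫₄) Q (parity n)
  option c with _ , refl , total′ ← total-cut (Tame.sound tame) total c =
    total-nimber n (tame-cut tame c) total′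

  below : ∀ m → m < 1 ∸ parity n → ∃[ Q ] Move 𝒫₄ P Q × Nimber (Move 𝒫₄) Q m
  below m m< with Q , c ← total-option {P} (λ ()) total =
    Q , cut⇒move tame c , subst (Nimber _ Q) (smaller (parity n) m<) (option c)
    where
    smaller : ∀ k {m} → m < 1 ∸ k → k ≡ m
    smaller zero          (s≤s z≤n) = refl
    smaller (suc zero)    ()
    smaller (suc (suc k)) ()

  avoid : ∀ Q → Move 𝒫₄ P Q → ∃[ m ] Nimber (Move 𝒫₄) Q m × m ≢ 1 ∸ parity n
  avoid Q st = parity n , option (move⇒cut tame st) , k≢1∸k (parity n)
    where
    k≢1∸k : ∀ k → k ≢ 1 ∸ k
    k≢1∸k zero          ()
    k≢1∸k (suc zero)    ()
    k≢1∸k (suc (suc k)) ()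

-- The opening

pair-split : ∀ {A : Set} {a b : A} xs {c} ys {d zs} → a ∷ b ∷ [] ≡ xs ++ c ∷ ys ++ d ∷ zs →
             xs ≡ [] × ys ≡ [] × zs ≡ [] × a ≡ c × b ≡ d
pair-split [] ys eq with a≡c , eq′ ← ∷-injective eq with ys≡ , b≡d , zs≡ ← singleton-split ys eq′ =
  refl , ys≡ , zs≡ , a≡c , b≡d
pair-split (_ ∷ xs) ys eq with _ , _ , none ← singleton-split xs (proj₂ (∷-injective eq)) =
  contradiction none (append-cons≢[] ys)

-- The tips of a spot are interchangeable: whichever is used, the boundary read from that place is
-- the same word. So all openings give literally equal positions.
replicate-remove : ∀ {n} {v x : Vertex} A B → replicate (suc n) v ≡ A ++ x ∷ B →
                   x ≡ v × B ++ A ≡ replicate n v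
replicate-remove {n} {v} {x} A B eq
  with A≡ , x≡v ∷ B≡ ← ++⁻ A (subst (All (_≡ v)) eq (replicate⁺ (suc n) refl))
  = x≡v , trans (all-same (++⁺ B≡ A≡)) (cong (λ k → replicate k v) (suc-injective (begin
      suc (length (B ++ A))           ≡⟨ cong suc (length-++-comm B A) ⟩
      suc (length (A ++ B))           ≡⟨ length-++-sucʳ A x B ⟨
      length (A ++ x ∷ B)             ≡⟨ cong length eq ⟨
      length (replicate (suc n) v)    ≡⟨ length-replicate (suc n) ⟩
      suc n                           ∎)))
  where open ≡-Reasoning

replicate-snoc : ∀ n (v : Vertex) xs → replicate (suc n) v ++ xs ≡ replicate n v ++ v ∷ xs
replicate-snoc zero    v xs = refl
replicate-snoc (suc n) v xs = cong (v ∷_) (replicate-snoc n v xs)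

joined : ℕ → ℕ → Position
joined p q = position (subdividedEdge 0 1 (graph 2 []))
  [ [ replicate p 0 ++ 2 ∷ replicate q 1 ++ [ 2 ] ] ]

opening-unique : ∀ {p q Q} → Move 𝒫₄ (start (suc p) (suc q)) Q → Q ≡ joined p q
opening-unique {p} {q} (move Rs₁ R Rs₂ eq conn girth) with refl , refl , refl ← singleton-split Rs₁ eq with conn
-- Each boundary component carries the tips of one spot only, so this curve would create a digon.
... | same Cs₁ A B C Cs₂ eq′ _
  with v , v< , W≡ ← All.head (++⁻ʳ Cs₁ (subst (All λ W → ∃[ v ] v < 2 × All (_≡ v) W) eq′
         ((0 , s≤s z≤n , replicate⁺ (suc p) refl) ∷ (1 , s≤s (s≤s z≤n) , replicate⁺ (suc q) refl) ∷ [])))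
  with refl ∷ <₂ ← ++⁻ʳ A W≡
  with y≡v ∷ _ ← ++⁻ʳ B <₂
  = contradiction (sym y≡v) (girth⇒distinct v< girth)
... | different Cs₁ A B Cs₂ C D Cs₃ eq′
  with refl , refl , refl , p≡ , q≡ ← pair-split Cs₁ Cs₂ eq′
  with refl , BA≡ ← replicate-remove A B p≡ | refl , DC≡ ← replicate-remove C D q≡
  = cong (λ W → position (subdividedEdge 0 1 (graph 2 [])) [ [ W ] ]) (begin
      B ++ A ++ [ 2 ] ++ D ++ C ++ [ 2 ]           ≡⟨ ++-assoc B A _ ⟨
      (B ++ A) ++ 2 ∷ (D ++ C ++ [ 2 ])            ≡⟨ cong (λ W → (B ++ A) ++ 2 ∷ W) (++-assoc D C [ 2 ]) ⟨
      (B ++ A) ++ 2 ∷ (D ++ C) ++ [ 2 ]            ≡⟨ cong₂ (λ V W → V ++ 2 ∷ W ++ [ 2 ]) BA≡ DC≡ ⟩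
      replicate p 0 ++ 2 ∷ replicate q 1 ++ [ 2 ]  ∎)
  where open ≡-Reasoning

joined-tame : ∀ p q → Tame (joined p q)
joined-tame p q = record
  { sound = joinable⇒sound empty (record
      { left< = s≤s z≤n ; right< = s≤s (s≤s z≤n) ; distinct = λ () ; nonadjacent = λ () })
  ; words = (_ , refl , ++⁺ (replicate⁺ p (s≤s z≤n))
                            (n<1+n 2 ∷ ++⁺ (replicate⁺ q (s≤s (s≤s z≤n))) (n<1+n 2 ∷ []))) ∷ []
  }
  where
  empty : Sound (graph 2 [])
  empty = record
    { girth   = λ { {suc k} c → case Cycle.edge c zero of λ () }
    ; bounded = λ ()
    }

-- The graph is the 4-cycle 0, 2, 1, 3, with the spots opposite each other and one region on either
-- side.
square : ℕ → ℕ → Position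
square p q = position (subdividedEdge 0 1 (subdividedEdge 0 1 (graph 2 [])))
  ([ 2 ∷ replicate q 1 ++ [ 3 ] ] ∷ [ 2 ∷ replicate p 0 ++ [ 3 ] ] ∷ [])

reply : ∀ p q → Cut (joined (suc p) (suc q)) (square p q)
reply p q = cut [] (replicate p 0) 0 (2 ∷ replicate q 1) 1 [ 2 ] [] (cong (λ W → [ [ W ] ]) (begin
    replicate (suc p) 0 ++ 2 ∷ replicate (suc q) 1 ++ [ 2 ]    ≡⟨ replicate-snoc p 0 _ ⟩
    replicate p 0 ++ 0 ∷ 2 ∷ replicate (suc q) 1 ++ [ 2 ]      ≡⟨ cong (λ W → replicate p 0 ++ 0 ∷ 2 ∷ W) (replicate-snoc q 1 _) ⟩
    replicate p 0 ++ 0 ∷ (2 ∷ replicate q 1) ++ 1 ∷ [ 2 ]      ∎))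
  (record { left<       = s≤s z≤n
          ; right<      = s≤s (s≤s z≤n)
          ; distinct    = λ ()
          ; nonadjacent = from-no (adjacent? (subdividedEdge 0 1 (graph 2 [])) 0 1) })
  where open ≡-Reasoning

square-total : ∀ p q → Total (drawn (square (suc p) (suc q))) (regions (square (suc p) (suc q))) 4
square-total p q =
    -- The indices are positions in the edge list (0,3), (3,1), (0,2), (2,1). The block is at 1 in
    -- this region and at 0 in the next; each lasts two moves.
    twice q opposite (suc (suc (suc zero)) , inj₁ refl) (suc zero , inj₂ refl) (λ ()) (λ ())
  ∷ twice p opposite (suc (suc zero) , inj₂ refl) (zero , inj₁ refl) (λ ()) (λ ())
  ∷ []
  where
  opposite : Joinable (subdividedEdge 0 1 (subdividedEdge 0 1 (graph 2 []))) 2 3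
  opposite = record
    { left<       = s≤s (s≤s (s≤s z≤n))
    ; right<      = n<1+n 3
    ; distinct    = λ ()
    ; nonadjacent = from-no (adjacent? (subdividedEdge 0 1 (subdividedEdge 0 1 (graph 2 []))) 2 3)
    }

theorem6p1 : (p q : ℕ) → 3 ≤ p → 3 ≤ q → Nimber (Move 𝒫₄) (start p q) 0
theorem6p1 (suc (suc (suc p))) (suc (suc (suc q))) (s≤s (s≤s (s≤s _))) (s≤s (s≤s (s≤s _))) =
  mex (λ _ ()) avoid
  where
  tame = joined-tame (suc (suc p)) (suc (suc q))

  -- Each spot has spent one tip on the opening and one on the reply; with three or more at the
  -- start, both blocks are nonempty. Four remaining moves have parity 0.
  reply-nimber : Nimber (Move 𝒫₄) (square (suc p) (suc q)) 0
  reply-nimber = total-nimber 4 (tame-cut tame (reply (suc p) (suc q))) (square-total p q)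

  nonzero : ∀ {m} → Nimber (Move 𝒫₄) (joined (suc (suc p)) (suc (suc q))) m → m ≢ 0
  nonzero (mex _ distinct) refl
    -- A nimber 0 here would forbid options of nimber 0, but the reply leads to one.
    with _ , Qk , k≢0 ← distinct _ (cut⇒move tame (reply (suc p) (suc q))) =
    k≢0 (nimber-unique Qk reply-nimber)

  avoid : ∀ Q → Move 𝒫₄ (start (3 + p) (3 + q)) Q → ∃[ m ] Nimber (Move 𝒫₄) Q m × m ≢ 0
  avoid Q st with refl ← opening-unique st with m , Qm ← tame-nimber tame = m , Qm , nonzero Qm
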